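{- For $15$ symbols, $6$ rows and $10$ columns: there is no proper transposed sesqui array, i.e. there is no $6\times 10$ row-column design on $15$ symbols (with replication number $4$) that satisfies (CC) and (RC) but not (RR). There do, however, exist proper AO-arrays with these parameters (row-column designs satisfying (RC) but neither (RR) nor (CC)), and there also exist triple arrays with these parameters (row-column designs satisfying (RR), (CC) and (RC)).
   Context: A row-column design is an $r\times c$ array on $v$ symbols such that no symbol occurs more than once in any row or any column, and every symbol occurs exactly $e$ times in the array (so $ev=rc$). Identify rows and columns with their symbol sets. (RR): there is a constant $\lambda_{rr}$ such that any two distinct rows have exactly $\lambda_{rr}$ common symbols. (CC): there is a constant $\lambda_{cc}$ such that any two distinct columns have exactly $\lambda_{cc}$ common symbols. (RC): there is a constant $\lambda_{rc}$ such that any row and any column have exactly $\lambda_{rc}$ common symbols. -}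

module Defs where

open import Data.Fin using (Fin; _≟_)
open import Data.Fin.Properties using (any?)
open import Data.Fin.Subset using (Subset; _∩_; ∣_∣)
open import Data.List using (length; filter; allFin; cartesianProduct)
open import Data.Nat using (ℕ)
open import Data.Product using (_×_; _,_; ∃-syntax)
open import Data.Vec using (tabulate)
open import Function.Definitions using (Injective)
open import Relation.Binary.PropositionalEquality using (_≡_; _≢_)
open import Relation.Nullary using (¬_)
open import Relation.Nullary.Decidable using (⌊_⌋)

Array : (r c v : ℕ) → Set
Array r c v = Fin r → Fin c → Fin v

module _ {r c v : ℕ} (A : Array r c v) where

  occurrences : Fin v → ℕ
  occurrences s =
    length (filter (λ (i , j) → A i j ≟ s) (cartesianProduct (allFin r) (allFin c)))

  rowSet : Fin r → Subset v
  rowSet i = tabulate (λ s → ⌊ any? (λ j → A i j ≟ s) ⌋)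

  colSet : Fin c → Subset v
  colSet j = tabulate (λ s → ⌊ any? (λ i → A i j ≟ s) ⌋)

  RR : Set
  RR = ∃[ λrr ] (∀ i i′ → i ≢ i′ → ∣ rowSet i ∩ rowSet i′ ∣ ≡ λrr)

  CC : Set
  CC = ∃[ λcc ] (∀ j j′ → j ≢ j′ → ∣ colSet j ∩ colSet j′ ∣ ≡ λcc)

  RC : Set
  RC = ∃[ λrc ] (∀ i j → ∣ rowSet i ∩ colSet j ∣ ≡ λrc)

-- The identity e * v ≡ r * c is not a field: it follows from `replication`
-- by counting cells.
record IsRowColumnDesign {r c v : ℕ} (e : ℕ) (A : Array r c v) : Set where
  field
    row-distinct : ∀ i → Injective _≡_ _≡_ (A i)
    col-distinct : ∀ j → Injective _≡_ _≡_ (λ i → A i j)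
    replication  : ∀ s → occurrences A s ≡ e

module _ {r c v : ℕ} (e : ℕ) (A : Array r c v) where

  IsTripleArray : Set
  IsTripleArray = IsRowColumnDesign e A × RR A × CC A × RC A

  IsProperTransposedSesquiArray : Set
  IsProperTransposedSesquiArray = IsRowColumnDesign e A × CC A × RC A × ¬ RR A

  IsProperAOArray : Set
  IsProperAOArray = IsRowColumnDesign e A × RC A × ¬ RR A × ¬ CC A

{-# OPTIONS --safe #-}
-- If CC and RC hold then RR holds.  Counting forces λcc = 2 and λrc = 4, so the
-- columns are the points of a quasi-residual 2-(10,4,2) design whose blocks are
-- the symbols.  Two symbols s ≠ t share μ ∈ {1,2} columns, because
-- ∑ (μ - 1)(μ - 2) = 0 over t; call them adjacent if μ = 1.  The resulting graph
-- is strongly regular with parameters (15,8,4,4).  The five symbols missing from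
-- a row meet each column twice, and a count shows that they form a 5-clique to
-- which every other symbol has two neighbours.  Two such cliques are never
-- disjoint.  Each symbol is missing from exactly two rows, so the five other
-- cliques meet a given one in 5 symbols altogether, hence in one symbol each;
-- therefore any two rows share 15 - 5 - 5 + 1 = 6 symbols.
module Submission where

open import Data.Bool using (Bool; true; false; if_then_else_)
open import Data.Empty using (⊥; ⊥-elim)
open import Data.Fin using (Fin; zero; suc; _≟_)
open import Data.Fin.Patterns using (0F; 1F; 2F; 3F)
open import Data.Fin.Properties using (any?; all?; suc-injective)
open import Data.Fin.Subset using (_∩_; ∣_∣)
open import Data.Integer
  using (ℤ; +_; -[1+_]; +[1+_]; 0ℤ; 1ℤ; -1ℤ; _+_; _-_; _*_; -_; _≤_; +≤+; -≤+; _≤?_)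
import Data.Integer.Properties as ℤ
open import Data.Integer.Tactic.RingSolver using (solve-∀)
open import Data.List using (List; length; filter; cartesianProduct; _++_)
import Data.List as List
import Data.List.Properties as List
open import Data.Nat using (ℕ; zero; suc; z≤n; s≤s)
import Data.Nat as ℕ
open import Data.Nat.DivMod using (_mod_)
import Data.Nat.Properties as ℕ
open import Data.Product using (_×_; _,_; Σ-syntax)
open import Data.Sum using (_⊎_; inj₁; inj₂)
open import Data.Vec using (Vec; []; _∷_; lookup; tabulate)
open import Function using (_∘_; case_of_)
open import Function.Definitions using (Injective)
open import Relation.Binary.PropositionalEquality
open import Relation.Nullary using (¬_; Dec; does; yes; no)
open import Relation.Nullary.Decidable
  using (from-yes; ⌊_⌋; isYes≗does; map′; _→-dec_; _×-dec_; ¬?; toWitnessFalse)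
open import Relation.Unary using (Decidable)
open import Defs

open import Algebra.Properties.Semiring.Sum ℤ.+-*-semiring
  using (sum; sum-syntax; sum-cong-≗; sum-replicate-zero; ∑-distrib-+; ∑-comm; *-distribˡ-sum)

-- Finite sums of integers.

infix 4 _HasSum_
infixl 6 _⊕_
infixr 7 _⊙_

-- A record rather than an equation so that f can be inferred from a proof.
record _HasSum_ {n} (f : Fin n → ℤ) (a : ℤ) : Set where
  constructor hasSum
  field total : sum f ≡ a

open _HasSum_ public

_⊕_ : ∀ {n} {f g : Fin n → ℤ} {a b} → f HasSum a → g HasSum b → (λ i → f i + g i) HasSum (a + b)
_⊕_ {f = f} {g} (hasSum p) (hasSum q) = hasSum (trans (∑-distrib-+ f g) (cong₂ _+_ p q))

_⊙_ : ∀ {n} {f : Fin n → ℤ} {a} k → f HasSum a → (λ i → k * f i) HasSum (k * a)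
_⊙_ {f = f} k (hasSum p) = hasSum (trans (sym (*-distribˡ-sum k f)) (cong (k *_) p))

const-hasSum : ∀ {n} k → (λ (_ : Fin n) → k) HasSum + n * k
const-hasSum {zero}  k = hasSum refl
const-hasSum {suc n} k = hasSum (trans (cong (λ a → k + a) (total (const-hasSum {n} k))) (sym (ℤ.suc-* (+ n) k)))

-- The bilinear form of `K` in `a` and `b`, evaluated in either order. With `K` an adjacency or
-- incidence matrix this is double counting of paths or flags.
sum-adjoint : ∀ {m n} (a : Fin n → ℤ) (b : Fin m → ℤ) (K : Fin m → Fin n → ℤ) →
  ∑[ j < n ] (a j * ∑[ i < m ] (b i * K i j)) ≡ ∑[ i < m ] (b i * ∑[ j < n ] (a j * K i j))
sum-adjoint {m} {n} a b K = begin
  ∑[ j < n ] (a j * ∑[ i < m ] (b i * K i j))    ≡⟨ sum-cong-≗ (λ j → *-distribˡ-sum (a j) (λ i → b i * K i j)) ⟩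
  ∑[ j < n ] ∑[ i < m ] (a j * (b i * K i j))    ≡⟨ ∑-comm (λ j i → a j * (b i * K i j)) ⟩
  ∑[ i < m ] ∑[ j < n ] (a j * (b i * K i j))    ≡⟨ sum-cong-≗ (λ i → sum-cong-≗ (λ j → exchange (a j) (b i) (K i j))) ⟩
  ∑[ i < m ] ∑[ j < n ] (b i * (a j * K i j))    ≡⟨ sum-cong-≗ (λ i → sym (*-distribˡ-sum (b i) (λ j → a j * K i j))) ⟩
  ∑[ i < m ] (b i * ∑[ j < n ] (a j * K i j))    ∎
  where
  open ≡-Reasoning
  exchange : ∀ x y z → x * (y * z) ≡ y * (x * z)
  exchange = solve-∀

sum-nonneg : ∀ {n} {f : Fin n → ℤ} → (∀ i → 0ℤ ≤ f i) → 0ℤ ≤ sum f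
sum-nonneg {zero}  h = ℤ.≤-refl
sum-nonneg {suc n} h = ℤ.+-mono-≤ (h zero) (sum-nonneg (h ∘ suc))

term≤sum : ∀ {n} {f : Fin n → ℤ} → (∀ i → 0ℤ ≤ f i) → ∀ i → f i ≤ sum f
term≤sum {f = f} h zero    = subst (_≤ sum f) (ℤ.+-identityʳ _) (ℤ.+-monoʳ-≤ (f zero) (sum-nonneg (h ∘ suc)))
term≤sum {f = f} h (suc i) = ℤ.≤-trans (term≤sum (h ∘ suc) i)
  (subst (_≤ sum f) (ℤ.+-identityˡ _) (ℤ.+-monoˡ-≤ (sum (f ∘ suc)) (h zero)))

-- Each term is squeezed between 0 and the total. This is how counting identities below become
-- pointwise statements.
hasSum-0⇒≡0 : ∀ {n} {f : Fin n → ℤ} → (∀ i → 0ℤ ≤ f i) → f HasSum 0ℤ → ∀ i → f i ≡ 0ℤ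
hasSum-0⇒≡0 h (hasSum eq) i = ℤ.≤-antisym (subst (_ ≤_) eq (term≤sum h i)) (h i)

sum-mono-≤ : ∀ {n} {f g : Fin n → ℤ} → (∀ i → f i ≤ g i) → sum f ≤ sum g
sum-mono-≤ {zero}  h = ℤ.≤-refl
sum-mono-≤ {suc n} h = ℤ.+-mono-≤ (h zero) (sum-mono-≤ (h ∘ suc))

-- Squares and idempotents in ℤ.

0≤i*i : ∀ i → 0ℤ ≤ i * i
0≤i*i (+ 0)      = +≤+ z≤n
0≤i*i +[1+ n ]   = +≤+ z≤n
0≤i*i -[1+ n ]   = +≤+ z≤n

i≤i*i : ∀ i → i ≤ i * i
i≤i*i (+ 0)      = +≤+ z≤n
i≤i*i +[1+ n ]   = +≤+ (ℕ.m≤m*n (suc n) (suc n))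
i≤i*i -[1+ n ]   = -≤+

-- The idempotents of ℤ are 0 and 1, so this encodes indicator values. As an equation it can be
-- rewritten with inside ring identities, without case splits.
Idempotent : ℤ → Set
Idempotent i = i * i ≡ i

idem⇒0≤ : ∀ {i} → Idempotent i → 0ℤ ≤ i
idem⇒0≤ {i} p = subst (0ℤ ≤_) p (0≤i*i i)

idem⇒0∨1 : ∀ {i} → Idempotent i → i ≡ 0ℤ ⊎ i ≡ 1ℤ
idem⇒0∨1 {i} p with ℤ.i*j≡0⇒i≡0∨j≡0 i {i - 1ℤ} (trans (expand i) (ℤ.i≡j⇒i-j≡0 p))
  where
  expand : ∀ i → i * (i - 1ℤ) ≡ i * i - i
  expand = solve-∀
... | inj₁ q = inj₁ q
... | inj₂ q = inj₂ (ℤ.i-j≡0⇒i≡j i 1ℤ q)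

idem-* : ∀ {i j} → Idempotent i → Idempotent j → Idempotent (i * j)
idem-* {i} {j} p q = trans (rearrange i j) (cong₂ _*_ p q)
  where
  rearrange : ∀ i j → (i * j) * (i * j) ≡ (i * i) * (j * j)
  rearrange = solve-∀

idem-complement : ∀ {i} → Idempotent i → Idempotent (1ℤ - i)
idem-complement {i} p = trans (expand i) (trans (cong (λ k → 1ℤ - + 2 * i + k) p) (collect i))
  where
  expand : ∀ i → (1ℤ - i) * (1ℤ - i) ≡ 1ℤ - + 2 * i + i * i
  expand = solve-∀
  collect : ∀ i → 1ℤ - + 2 * i + i ≡ 1ℤ - i
  collect = solve-∀

-- The indicator of the complement of two disjoint sets; disjointness kills the cross term of the
-- square.
idem-1-i-j : ∀ {i j} → Idempotent i → Idempotent j → i * j ≡ 0ℤ → Idempotent (1ℤ - i - j)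
idem-1-i-j {i} {j} p q ij≡0 = begin
  (1ℤ - i - j) * (1ℤ - i - j)
    ≡⟨ expand i j ⟩
  1ℤ - + 2 * i - + 2 * j + i * i + j * j + + 2 * (i * j)
    ≡⟨ cong₂ (λ a b → 1ℤ - + 2 * i - + 2 * j + a + b + + 2 * (i * j)) p q ⟩
  1ℤ - + 2 * i - + 2 * j + i + j + + 2 * (i * j)
    ≡⟨ cong (λ k → 1ℤ - + 2 * i - + 2 * j + i + j + + 2 * k) ij≡0 ⟩
  1ℤ - + 2 * i - + 2 * j + i + j + + 2 * 0ℤ
    ≡⟨ collect i j ⟩
  1ℤ - i - j ∎
  where
  open ≡-Reasoning
  expand : ∀ i j → (1ℤ - i - j) * (1ℤ - i - j) ≡ 1ℤ - + 2 * i - + 2 * j + i * i + j * j + + 2 * (i * j)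
  expand = solve-∀
  collect : ∀ i j → 1ℤ - + 2 * i - + 2 * j + i + j + + 2 * 0ℤ ≡ 1ℤ - i - j
  collect = solve-∀

-- Indicators and the Kronecker delta.

𝟙 : Bool → ℤ
𝟙 b = if b then 1ℤ else 0ℤ

𝟙-idem : ∀ b → Idempotent (𝟙 b)
𝟙-idem false = refl
𝟙-idem true  = refl

δ : ∀ {n} → Fin n → Fin n → ℤ
δ i j = 𝟙 (does (i ≟ j))

δ-idem : ∀ {n} (i j : Fin n) → Idempotent (δ i j)
δ-idem i j = 𝟙-idem (does (i ≟ j))

δ-refl : ∀ {n} (i : Fin n) → δ i i ≡ 1ℤ
δ-refl i with i ≟ i
... | yes _  = refl
... | no i≢i = ⊥-elim (i≢i refl)

δ-≢ : ∀ {n} {i j : Fin n} → i ≢ j → δ i j ≡ 0ℤ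
δ-≢ {i = i} {j} i≢j with i ≟ j
... | yes i≡j = ⊥-elim (i≢j i≡j)
... | no _    = refl

δ-sym : ∀ {n} (i j : Fin n) → δ i j ≡ δ j i
δ-sym i j with i ≟ j
... | yes refl = sym (δ-refl i)
... | no i≢j   = sym (δ-≢ (i≢j ∘ sym))

δ*-hasSum : ∀ {n} (f : Fin n → ℤ) i → (λ j → δ i j * f j) HasSum f i
δ*-hasSum {suc n} f zero    = hasSum (begin
  1ℤ * f zero + ∑[ j < n ] (0ℤ * f (suc j))  ≡⟨ cong₂ _+_ (ℤ.*-identityˡ (f zero)) (sym (*-distribˡ-sum 0ℤ (f ∘ suc))) ⟩
  f zero + 0ℤ                                ≡⟨ ℤ.+-identityʳ (f zero) ⟩
  f zero                                     ∎)
  where open ≡-Reasoning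
δ*-hasSum {suc n} f (suc i) = hasSum (trans (ℤ.+-identityˡ _) (total (δ*-hasSum (f ∘ suc) i)))

δ-hasSum : ∀ {n} (i : Fin n) → δ i HasSum 1ℤ
δ-hasSum i = hasSum (trans (sum-cong-≗ (λ j → sym (ℤ.*-identityʳ (δ i j)))) (total (δ*-hasSum (λ _ → 1ℤ) i)))

-- 5-cliques in a strongly regular graph with parameters (15,8,4,4), where A² = 4J + 4I.

module Cliques
  (A : Fin 15 → Fin 15 → ℤ)
  (A-idem : ∀ s t → Idempotent (A s t))
  (A-sym : ∀ s t → A s t ≡ A t s)
  (A-loopless : ∀ s t → A s t * δ s t ≡ 0ℤ)
  (A-degree : ∀ s → A s HasSum + 8)
  (A-square : ∀ s t → ∑[ u < 15 ] (A s u * A t u) ≡ + 4 + + 4 * δ s t)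
  where

  -- A 5-set whose members have 4 neighbours in it and whose non-members have 2. Counting neighbours
  -- keeps `degree` linear in `x`; pairwise adjacency is recovered in `clique-adjacent`.
  record Clique (x : Fin 15 → ℤ) : Set where
    field
      idem   : ∀ t → Idempotent (x t)
      size   : x HasSum + 5
      degree : ∀ s → (λ t → A s t * x t) HasSum + 2 + + 2 * x s

  open Clique

  -- `missing` marks the members of the clique that are neither `s` nor adjacent to `s`. There are 5
  -- - 4 - 1 = 0 of them.
  clique-adjacent : ∀ {x s} → Clique x → x s ≡ 1ℤ → ∀ t → x t * A s t ≡ x t * (1ℤ - δ s t)
  clique-adjacent {x} {s} X xs≡1 t =
    sym (ℤ.i-j≡0⇒i≡j _ _ (trans (gather (x t) (A s t) (δ s t)) (hasSum-0⇒≡0 (idem⇒0≤ ∘ missing-idem) missing-sum t)))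
    where
    missing : Fin 15 → ℤ
    missing t = x t * (1ℤ - A s t - δ s t)
    gather : ∀ x a d → x * (1ℤ - d) - x * a ≡ x * (1ℤ - a - d)
    gather = solve-∀
    split : ∀ x a d → x * (1ℤ - a - d) ≡ x + -1ℤ * (a * x) + -1ℤ * (d * x)
    split = solve-∀
    missing-idem : ∀ t → Idempotent (missing t)
    missing-idem t = idem-* (idem X t) (idem-1-i-j (A-idem s t) (δ-idem s t) (A-loopless s t))
    missing-sum : missing HasSum 0ℤ
    missing-sum = hasSum (begin
      sum missing
        ≡⟨ sum-cong-≗ (λ t → split (x t) (A s t) (δ s t)) ⟩
      ∑[ t < 15 ] (x t + -1ℤ * (A s t * x t) + -1ℤ * (δ s t * x t))
        ≡⟨ total (size X ⊕ -1ℤ ⊙ degree X s ⊕ -1ℤ ⊙ δ*-hasSum x s) ⟩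
      + 5 + -1ℤ * (+ 2 + + 2 * x s) + -1ℤ * x s
        ≡⟨ cong (λ k → + 5 + -1ℤ * (+ 2 + + 2 * k) + -1ℤ * k) xs≡1 ⟩
      0ℤ ∎)
      where open ≡-Reasoning

  -- For a clique `w`, the number of common neighbours of `s` and `u` that lie in `w`.
  common : (Fin 15 → ℤ) → Fin 15 → Fin 15 → ℤ
  common w s u = ∑[ b < 15 ] ((w b * A s b) * A b u)

  common-hasSum : ∀ w s u → (λ b → (w b * A s b) * A b u) HasSum common w s u
  common-hasSum w s u = hasSum refl

  -- A member `u` is adjacent to all of `w` but itself, so the count is the number of neighbours of
  -- `s` in `w`, less one if `u` is among them.
  common-in-clique : ∀ {w u} → Clique w → w u ≡ 1ℤ → ∀ s → common w s u ≡ + 2 + + 2 * w s - A s u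
  common-in-clique {w} {u} W wu≡1 s = begin
    common w s u
      ≡⟨ sum-cong-≗ pointwise ⟩
    ∑[ b < 15 ] (A s b * w b + -1ℤ * (δ u b * (A s b * w b)))
      ≡⟨ total (degree W s ⊕ -1ℤ ⊙ δ*-hasSum (λ b → A s b * w b) u) ⟩
    + 2 + + 2 * w s + -1ℤ * (A s u * w u)
      ≡⟨ cong (λ k → + 2 + + 2 * w s + -1ℤ * (A s u * k)) wu≡1 ⟩
    + 2 + + 2 * w s + -1ℤ * (A s u * 1ℤ)
      ≡⟨ tidy (w s) (A s u) ⟩
    + 2 + + 2 * w s - A s u ∎
    where
    open ≡-Reasoning
    tidy : ∀ w a → + 2 + + 2 * w + -1ℤ * (a * 1ℤ) ≡ + 2 + + 2 * w - a
    tidy = solve-∀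
    regroup : ∀ w a c → (w * a) * c ≡ a * (w * c)
    regroup = solve-∀
    distribute : ∀ w a d → a * (w * (1ℤ - d)) ≡ a * w + -1ℤ * (d * (a * w))
    distribute = solve-∀
    pointwise : ∀ b → (w b * A s b) * A b u ≡ A s b * w b + -1ℤ * (δ u b * (A s b * w b))
    pointwise b = begin
      (w b * A s b) * A b u         ≡⟨ regroup (w b) (A s b) (A b u) ⟩
      A s b * (w b * A b u)         ≡⟨ cong (λ k → A s b * (w b * k)) (A-sym b u) ⟩
      A s b * (w b * A u b)         ≡⟨ cong (A s b *_) (clique-adjacent W wu≡1 b) ⟩
      A s b * (w b * (1ℤ - δ u b))  ≡⟨ distribute (w b) (A s b) (δ u b) ⟩
      A s b * w b + -1ℤ * (δ u b * (A s b * w b)) ∎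

  common-sym : ∀ w s u → common w s u ≡ common w u s
  common-sym w s u = sum-cong-≗ λ b → trans (swap (w b) (A s b) (A b u))
    (cong₂ (λ p q → (w b * p) * q) (A-sym b u) (A-sym s b))
    where
    swap : ∀ w p q → (w * p) * q ≡ (w * q) * p
    swap = solve-∀

  rest : (x y : Fin 15 → ℤ) → Fin 15 → ℤ
  rest x y t = 1ℤ - x t - y t

  -- The degree condition passes to the complement: 8 - (2 + 2x) - (2 + 2y) = 2 + 2(1 - x - y). Two
  -- disjoint cliques would thus partition the 15 vertices into three.
  rest-clique : ∀ {x y} → Clique x → Clique y → (∀ t → x t * y t ≡ 0ℤ) → Clique (rest x y)
  rest-clique {x} {y} X Y xy≡0 = record
    { idem   = λ t → idem-1-i-j (idem X t) (idem Y t) (xy≡0 t)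
    ; size   = hasSum (trans (sum-cong-≗ (λ t → negate (x t) (y t)))
        (total (const-hasSum 1ℤ ⊕ -1ℤ ⊙ size X ⊕ -1ℤ ⊙ size Y)))
    ; degree = λ s → hasSum (begin
        ∑[ t < 15 ] (A s t * rest x y t)
          ≡⟨ sum-cong-≗ (λ t → distribute (A s t) (x t) (y t)) ⟩
        ∑[ t < 15 ] (A s t + -1ℤ * (A s t * x t) + -1ℤ * (A s t * y t))
          ≡⟨ total (A-degree s ⊕ -1ℤ ⊙ degree X s ⊕ -1ℤ ⊙ degree Y s) ⟩
        + 8 + -1ℤ * (+ 2 + + 2 * x s) + -1ℤ * (+ 2 + + 2 * y s)
          ≡⟨ combine (x s) (y s) ⟩
        + 2 + + 2 * rest x y s ∎)
    }
    where
    open ≡-Reasoning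
    negate : ∀ a d → 1ℤ - a - d ≡ 1ℤ + -1ℤ * a + -1ℤ * d
    negate = solve-∀
    distribute : ∀ a x y → a * (1ℤ - x - y) ≡ a + -1ℤ * (a * x) + -1ℤ * (a * y)
    distribute = solve-∀
    combine : ∀ x y → + 8 + -1ℤ * (+ 2 + + 2 * x) + -1ℤ * (+ 2 + + 2 * y) ≡ + 2 + + 2 * (1ℤ - x - y)
    combine = solve-∀

  -- For a vertex s of x, f u counts the paths s – b – u with b in y.  Double
  -- counting gives ∑ f² = 24, but evaluating f on y and rest x y, and at s, gives at least 26.
  module _ {x y : Fin 15 → ℤ} (X : Clique x) (Y : Clique y)
           (xy≡0 : ∀ t → x t * y t ≡ 0ℤ) {s : Fin 15} (xs≡1 : x s ≡ 1ℤ) where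
    private
      z : Fin 15 → ℤ
      z = rest x y

      Z : Clique z
      Z = rest-clique X Y xy≡0

      -- `g` marks the neighbours of `s` in `y`. `h` is the lower bound for f²: with a = `A s u`, it
      -- is (2 - a)² = 4 - 3a on `y`, (2a)² = 4a on `z`, and 4 at `s`, using a² = a.
      f g h : Fin 15 → ℤ
      f u = common y s u
      g b = y b * A s b
      h u = y u * (+ 4 - + 3 * A s u) + + 4 * (z u * A s u) + + 4 * δ s u

      ys≡0 : y s ≡ 0ℤ
      ys≡0 = trans (sym (ℤ.*-identityˡ (y s))) (trans (cong (_* y s) (sym xs≡1)) (xy≡0 s))

      zs≡0 : z s ≡ 0ℤ
      zs≡0 = cong₂ (λ a b → 1ℤ - a - b) xs≡1 ys≡0

      g-sum : g HasSum + 2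
      g-sum = hasSum (trans (sum-cong-≗ (λ b → ℤ.*-comm (y b) (A s b)))
        (trans (total (degree Y s)) (cong (λ k → + 2 + + 2 * k) ys≡0)))

      -- As f = Ag, this is A²g = (4J + 4I)g, and `g` sums to 2.
      sum-Af : ∀ b → ∑[ u < 15 ] (A b u * f u) ≡ + 8 + + 4 * g b
      sum-Af b = begin
        ∑[ u < 15 ] (A b u * f u)
          ≡⟨ sum-adjoint (A b) g A ⟩
        ∑[ c < 15 ] (g c * ∑[ u < 15 ] (A b u * A c u))
          ≡⟨ sum-cong-≗ (λ c → trans (cong (g c *_) (A-square b c)) (distribute (g c) (δ b c))) ⟩
        ∑[ c < 15 ] (+ 4 * g c + + 4 * (δ b c * g c))
          ≡⟨ total (+ 4 ⊙ g-sum ⊕ + 4 ⊙ δ*-hasSum g b) ⟩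
        + 8 + + 4 * g b ∎
        where
        open ≡-Reasoning
        distribute : ∀ g d → g * (+ 4 + + 4 * d) ≡ + 4 * g + + 4 * (d * g)
        distribute = solve-∀

      -- Pairing `g` with A²g gives 8 · 2 + 4 · 2, because g² = g.
      sum-f² : ∑[ u < 15 ] (f u * f u) ≡ + 24
      sum-f² = begin
        ∑[ u < 15 ] (f u * f u)
          ≡⟨ sum-adjoint f g A ⟩
        ∑[ b < 15 ] (g b * ∑[ u < 15 ] (f u * A b u))
          ≡⟨ sum-cong-≗ (λ b → cong (g b *_) (trans (sum-cong-≗ (λ u → ℤ.*-comm (f u) (A b u))) (sum-Af b))) ⟩
        ∑[ b < 15 ] (g b * (+ 8 + + 4 * g b))
          ≡⟨ sum-cong-≗ (λ b → trans (distribute (g b)) (cong (λ k → + 8 * g b + + 4 * k) (idem-* (idem Y b) (A-idem s b)))) ⟩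
        ∑[ b < 15 ] (+ 8 * g b + + 4 * g b)
          ≡⟨ total (+ 8 ⊙ g-sum ⊕ + 4 ⊙ g-sum) ⟩
        + 24 ∎
        where
        open ≡-Reasoning
        distribute : ∀ g → g * (+ 8 + + 4 * g) ≡ + 8 * g + + 4 * (g * g)
        distribute = solve-∀

      sum-h : sum h ≡ + 26
      sum-h = begin
        sum h
          ≡⟨ sum-cong-≗ (λ u → distribute (x u) (y u) (A s u) (δ s u)) ⟩
        ∑[ u < 15 ] (+ 4 * y u + - + 3 * (A s u * y u) + + 4 * (A s u * z u) + + 4 * δ s u)
          ≡⟨ total (+ 4 ⊙ size Y ⊕ - + 3 ⊙ degree Y s ⊕ + 4 ⊙ degree Z s ⊕ + 4 ⊙ δ-hasSum s) ⟩
        + 20 + - + 3 * (+ 2 + + 2 * y s) + + 4 * (+ 2 + + 2 * z s) + + 4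
          ≡⟨ cong₂ (λ p q → + 20 + - + 3 * (+ 2 + + 2 * p) + + 4 * (+ 2 + + 2 * q) + + 4) ys≡0 zs≡0 ⟩
        + 26 ∎
        where
        open ≡-Reasoning
        distribute : ∀ x y a d → y * (+ 4 - + 3 * a) + + 4 * ((1ℤ - x - y) * a) + + 4 * d
          ≡ + 4 * y + - + 3 * (a * y) + + 4 * (a * (1ℤ - x - y)) + + 4 * d
        distribute = solve-∀

      f-on-y : ∀ {u} → y u ≡ 1ℤ → f u ≡ + 2 - A s u
      f-on-y {u} yu≡1 = trans (common-in-clique Y yu≡1 s) (cong (λ k → + 2 + + 2 * k - A s u) ys≡0)

      -- The three cliques partition the vertices, so the three counts add up to an entry of A².
      common-total : ∀ u → common x s u + f u + common z s u ≡ + 4 + + 4 * δ s u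
      common-total u = begin
        common x s u + f u + common z s u
          ≡⟨ sym (total (common-hasSum x s u ⊕ common-hasSum y s u ⊕ common-hasSum z s u)) ⟩
        ∑[ b < 15 ] (x b * A s b * A b u + y b * A s b * A b u + z b * A s b * A b u)
          ≡⟨ sum-cong-≗ (λ b → trans (cancel (x b) (y b) (A s b) (A b u)) (cong (A s b *_) (A-sym b u))) ⟩
        ∑[ b < 15 ] (A s b * A u b)
          ≡⟨ A-square s u ⟩
        + 4 + + 4 * δ s u ∎
        where
        open ≡-Reasoning
        cancel : ∀ x y p q → x * p * q + y * p * q + (1ℤ - x - y) * p * q ≡ p * q
        cancel = solve-∀

      -- The common neighbours in `x` and in `z` number 2 - a each, since `s` belongs to `x` and `u`
      -- to `z`; out of 4 in all, 2a remain for `y`.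
      f-on-z : ∀ {u} → z u ≡ 1ℤ → x u ≡ 0ℤ → δ s u ≡ 0ℤ → f u ≡ + 2 * A s u
      f-on-z {u} zu≡1 xu≡0 δsu≡0 = begin
        f u
          ≡⟨ isolate (common x s u) (f u) (common z s u) ⟩
        common x s u + f u + common z s u - common x s u - common z s u
          ≡⟨ cong₂ (λ p q → p - q - common z s u) (common-total u)
               (trans (common-sym x s u) (trans (common-in-clique X xs≡1 u) (cong₂ (λ p q → + 2 + + 2 * p - q) xu≡0 (A-sym u s)))) ⟩
        + 4 + + 4 * δ s u - (+ 2 + + 2 * 0ℤ - A s u) - common z s u
          ≡⟨ cong₂ (λ p q → + 4 + + 4 * p - (+ 2 + + 2 * 0ℤ - A s u) - q) δsu≡0
               (trans (common-in-clique Z zu≡1 s) (cong (λ p → + 2 + + 2 * p - A s u) zs≡0)) ⟩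
        + 4 + + 4 * 0ℤ - (+ 2 + + 2 * 0ℤ - A s u) - (+ 2 + + 2 * 0ℤ - A s u)
          ≡⟨ simplify (A s u) ⟩
        + 2 * A s u ∎
        where
        open ≡-Reasoning
        isolate : ∀ a b c → b ≡ a + b + c - a - c
        isolate = solve-∀
        simplify : ∀ a → + 4 + + 4 * 0ℤ - (+ 2 + + 2 * 0ℤ - a) - (+ 2 + + 2 * 0ℤ - a) ≡ + 2 * a
        simplify = solve-∀

      f-at-s : f s ≡ + 2
      f-at-s = trans (sum-cong-≗ λ b → trans (ℤ.*-assoc (y b) (A s b) (A b s))
        (cong (y b *_) (trans (cong (A s b *_) (A-sym b s)) (A-idem s b)))) (total g-sum)

      outside : ∀ {u} → x u ≡ 0ℤ → δ s u ≡ 0ℤ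
      outside {u} xu≡0 = δ-≢ {i = s} {u} λ { refl → 1≢0 (trans (sym xs≡1) xu≡0) }
        where
        1≢0 : 1ℤ ≢ 0ℤ
        1≢0 ()

      h≤f² : ∀ u → h u ≤ f u * f u
      h≤f² u with idem⇒0∨1 (idem Y u) | idem⇒0∨1 (idem Z u)
      ... | inj₂ yu≡1 | _ = ℤ.≤-reflexive (begin
        h u
          ≡⟨ cong₂ (λ p q → p * (+ 4 - + 3 * A s u) + + 4 * (q * A s u) + + 4 * δ s u) yu≡1 (cong₂ (λ p q → 1ℤ - p - q) xu≡0 yu≡1) ⟩
        1ℤ * (+ 4 - + 3 * A s u) + + 4 * (0ℤ * A s u) + + 4 * δ s u
          ≡⟨ cong (λ p → 1ℤ * (+ 4 - + 3 * A s u) + + 4 * (0ℤ * A s u) + + 4 * p) (outside xu≡0) ⟩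
        1ℤ * (+ 4 - + 3 * A s u) + + 4 * (0ℤ * A s u) + + 4 * 0ℤ
          ≡⟨ collect (A s u) ⟩
        + 4 - + 4 * A s u + A s u
          ≡⟨ cong (λ p → + 4 - + 4 * A s u + p) (sym (A-idem s u)) ⟩
        + 4 - + 4 * A s u + A s u * A s u
          ≡⟨ square (A s u) ⟩
        (+ 2 - A s u) * (+ 2 - A s u)
          ≡⟨ sym (cong₂ _*_ (f-on-y yu≡1) (f-on-y yu≡1)) ⟩
        f u * f u ∎)
        where
        open ≡-Reasoning
        xu≡0 : x u ≡ 0ℤ
        xu≡0 = trans (sym (ℤ.*-identityʳ (x u))) (trans (cong (x u *_) (sym yu≡1)) (xy≡0 u))
        collect : ∀ a → 1ℤ * (+ 4 - + 3 * a) + + 4 * (0ℤ * a) + + 4 * 0ℤ ≡ + 4 - + 4 * a + a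
        collect = solve-∀
        square : ∀ a → + 4 - + 4 * a + a * a ≡ (+ 2 - a) * (+ 2 - a)
        square = solve-∀
      ... | inj₁ yu≡0 | inj₂ zu≡1 = ℤ.≤-reflexive (begin
        h u
          ≡⟨ cong₂ (λ p q → p * (+ 4 - + 3 * A s u) + + 4 * (q * A s u) + + 4 * δ s u) yu≡0 zu≡1 ⟩
        0ℤ * (+ 4 - + 3 * A s u) + + 4 * (1ℤ * A s u) + + 4 * δ s u
          ≡⟨ cong₂ (λ p q → 0ℤ * (+ 4 - + 3 * A s u) + + 4 * (1ℤ * p) + + 4 * q) (sym (A-idem s u)) (outside xu≡0) ⟩
        0ℤ * (+ 4 - + 3 * A s u) + + 4 * (1ℤ * (A s u * A s u)) + + 4 * 0ℤ
          ≡⟨ square (A s u) ⟩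
        (+ 2 * A s u) * (+ 2 * A s u)
          ≡⟨ sym (cong₂ _*_ fu fu) ⟩
        f u * f u ∎)
        where
        open ≡-Reasoning
        isolate : ∀ x y → x ≡ 1ℤ - y - (1ℤ - x - y)
        isolate = solve-∀
        xu≡0 : x u ≡ 0ℤ
        xu≡0 = trans (isolate (x u) (y u)) (cong₂ (λ p q → 1ℤ - p - q) yu≡0 zu≡1)
        fu : f u ≡ + 2 * A s u
        fu = f-on-z zu≡1 xu≡0 (outside xu≡0)
        square : ∀ a → 0ℤ * (+ 4 - + 3 * a) + + 4 * (1ℤ * (a * a)) + + 4 * 0ℤ ≡ (+ 2 * a) * (+ 2 * a)
        square = solve-∀
      -- Here `u` lies in `x`, and `h` vanishes except at `s`, where both sides are 4.
      ... | inj₁ yu≡0 | inj₁ zu≡0 = subst (_≤ f u * f u) (sym hu) 4δ≤f²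
        where
        collect : ∀ a d → 0ℤ * (+ 4 - + 3 * a) + + 4 * (0ℤ * a) + + 4 * d ≡ + 4 * d
        collect = solve-∀
        hu : h u ≡ + 4 * δ s u
        hu = trans (cong₂ (λ p q → p * (+ 4 - + 3 * A s u) + + 4 * (q * A s u) + + 4 * δ s u) yu≡0 zu≡0)
          (collect (A s u) (δ s u))
        4δ≤f² : + 4 * δ s u ≤ f u * f u
        4δ≤f² with s ≟ u
        ... | yes refl = ℤ.≤-reflexive (sym (cong₂ _*_ f-at-s f-at-s))
        ... | no _     = 0≤i*i (f u)

    disjoint-cliques-impossible : ⊥
    disjoint-cliques-impossible = toWitnessFalse {a? = + 26 ≤? + 24} _ (subst₂ _≤_ sum-h sum-f² (sum-mono-≤ {f = h} {g = λ u → f u * f u} h≤f²))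

  -- If the intersection were empty, any vertex of `x` could serve as the `s` of the contradiction
  -- above; so `x` would be empty, against its size 5.
  cliques-meet : ∀ {x y} → Clique x → Clique y → 1ℤ ≤ ∑[ t < 15 ] (x t * y t)
  cliques-meet {x} {y} X Y = positive (sum-nonneg nonneg) λ eq → 0≢5 (begin
    0ℤ       ≡⟨ sym (sum-cong-≗ (x≡0 (hasSum-0⇒≡0 nonneg (hasSum eq)))) ⟩
    sum x    ≡⟨ total (size X) ⟩
    + 5      ∎)
    where
    open ≡-Reasoning
    nonneg : ∀ t → 0ℤ ≤ x t * y t
    nonneg t = idem⇒0≤ (idem-* (idem X t) (idem Y t))
    x≡0 : (∀ t → x t * y t ≡ 0ℤ) → ∀ t → x t ≡ 0ℤ
    x≡0 xy≡0 t with idem⇒0∨1 (idem X t)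
    ... | inj₁ xt≡0 = xt≡0
    ... | inj₂ xt≡1 = ⊥-elim (disjoint-cliques-impossible X Y xy≡0 xt≡1)
    0≢5 : 0ℤ ≢ + 5
    0≢5 ()
    positive : ∀ {k} → 0ℤ ≤ k → k ≢ 0ℤ → 1ℤ ≤ k
    positive {+ 0}      _ k≢0 = ⊥-elim (k≢0 refl)
    positive {+[1+ n ]} _ _   = +≤+ (s≤s z≤n)

-- The graph on the symbols of a column design; C is its 10 × 15 incidence matrix, with CCᵀ = 2J +
-- 4I.

module ColumnDesign
  (C : Fin 10 → Fin 15 → ℤ)
  (C-idem : ∀ p s → Idempotent (C p s))
  (C-size : ∀ p → C p HasSum + 6)
  (C-replication : ∀ s → (λ p → C p s) HasSum + 4)
  (C-gram : ∀ p q → ∑[ s < 15 ] (C p s * C q s) ≡ + 2 + + 4 * δ p q)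
  where

  -- The matrix CᵀC: how many columns contain both symbols.
  μ : Fin 15 → Fin 15 → ℤ
  μ s t = ∑[ p < 10 ] (C p s * C p t)

  μ-sym : ∀ s t → μ s t ≡ μ t s
  μ-sym s t = sum-cong-≗ λ p → ℤ.*-comm (C p s) (C p t)

  μ-refl : ∀ s → μ s s ≡ + 4
  μ-refl s = trans (sum-cong-≗ λ p → C-idem p s) (total (C-replication s))

  -- If Cw = v, then (CᵀC)w = Cᵀv.
  μ-weighted : ∀ (w : Fin 15 → ℤ) {v : Fin 10 → ℤ} → (∀ p → ∑[ t < 15 ] (w t * C p t) ≡ v p) →
    ∀ s → ∑[ t < 15 ] (w t * μ s t) ≡ ∑[ p < 10 ] (C p s * v p)
  μ-weighted w wC≡v s = trans (sum-adjoint w (λ p → C p s) C) (sum-cong-≗ λ p → cong (C p s *_) (wC≡v p))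

  μ-scaled : ∀ (w : Fin 15 → ℤ) k → (∀ p → ∑[ t < 15 ] (w t * C p t) ≡ k) →
    ∀ s → (λ t → w t * μ s t) HasSum k * + 4
  μ-scaled w k wC≡k s = hasSum (begin
    ∑[ t < 15 ] (w t * μ s t)   ≡⟨ μ-weighted w wC≡k s ⟩
    ∑[ p < 10 ] (C p s * k)     ≡⟨ sum-cong-≗ (λ p → ℤ.*-comm (C p s) k) ⟩
    ∑[ p < 10 ] (k * C p s)     ≡⟨ total (k ⊙ C-replication s) ⟩
    k * + 4                     ∎)
    where open ≡-Reasoning

  μ-sum : ∀ s → μ s HasSum + 24
  μ-sum s = hasSum (trans (sum-cong-≗ (λ t → sym (ℤ.*-identityˡ (μ s t))))
    (total (μ-scaled (λ _ → 1ℤ) (+ 6) (λ p → trans (sum-cong-≗ (λ t → ℤ.*-identityˡ (C p t))) (total (C-size p))) s)))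

  -- Associativity: (CᵀC)Cᵀ = Cᵀ(CCᵀ) = Cᵀ(2J + 4I), with four columns through each symbol.
  μC-sum : ∀ t p → ∑[ u < 15 ] (μ t u * C p u) ≡ + 8 + + 4 * C p t
  μC-sum t p = begin
    ∑[ u < 15 ] (μ t u * C p u)
      ≡⟨ sum-cong-≗ (λ u → ℤ.*-comm (μ t u) (C p u)) ⟩
    ∑[ u < 15 ] (C p u * μ t u)
      ≡⟨ sum-adjoint (C p) (λ q → C q t) C ⟩
    ∑[ q < 10 ] (C q t * ∑[ u < 15 ] (C p u * C q u))
      ≡⟨ sum-cong-≗ (λ q → trans (cong (C q t *_) (C-gram p q)) (distribute (C q t) (δ p q))) ⟩
    ∑[ q < 10 ] (+ 2 * C q t + + 4 * (δ p q * C q t))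
      ≡⟨ total (+ 2 ⊙ C-replication t ⊕ + 4 ⊙ δ*-hasSum (λ q → C q t) p) ⟩
    + 8 + + 4 * C p t ∎
    where
    open ≡-Reasoning
    distribute : ∀ c d → c * (+ 2 + + 4 * d) ≡ + 2 * c + + 4 * (d * c)
    distribute = solve-∀

  μ-hasSum : ∀ s t → (λ p → C p s * C p t) HasSum μ s t
  μ-hasSum s t = hasSum refl

  -- Cᵀ(2J + 4I)C, where the first term contributes 2 · 4 · 4 = 32.
  μ-square : ∀ s t → (λ u → μ s u * μ t u) HasSum + 32 + + 4 * μ s t
  μ-square s t = hasSum (begin
    ∑[ u < 15 ] (μ s u * μ t u)
      ≡⟨ sum-cong-≗ (λ u → ℤ.*-comm (μ s u) (μ t u)) ⟩
    ∑[ u < 15 ] (μ t u * μ s u)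
      ≡⟨ μ-weighted (μ t) (μC-sum t) s ⟩
    ∑[ p < 10 ] (C p s * (+ 8 + + 4 * C p t))
      ≡⟨ sum-cong-≗ (λ p → distribute (C p s) (C p t)) ⟩
    ∑[ p < 10 ] (+ 8 * C p s + + 4 * (C p s * C p t))
      ≡⟨ total (+ 8 ⊙ C-replication s ⊕ + 4 ⊙ μ-hasSum s t) ⟩
    + 32 + + 4 * μ s t ∎)
    where
    open ≡-Reasoning
    distribute : ∀ a b → a * (+ 8 + + 4 * b) ≡ + 8 * a + + 4 * (a * b)
    distribute = solve-∀

  -- Off the diagonal this is 2 - μ; on the diagonal μ = 4 and it vanishes.
  A : Fin 15 → Fin 15 → ℤ
  A s t = + 2 - μ s t + + 2 * δ s t

  A-sym : ∀ s t → A s t ≡ A t s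
  A-sym s t = cong₂ (λ m d → + 2 - m + + 2 * d) (μ-sym s t) (δ-sym s t)

  A-loopless : ∀ s t → A s t * δ s t ≡ 0ℤ
  A-loopless s t with s ≟ t
  ... | yes refl = cong (λ m → (+ 2 - m + + 2) * 1ℤ) (μ-refl s)
  ... | no _     = ℤ.*-zeroʳ (+ 2 - μ s t + 0ℤ)

  A-degree : ∀ s → A s HasSum + 8
  A-degree s = hasSum (trans (sum-cong-≗ (λ t → split (μ s t) (δ s t)))
    (total (const-hasSum (+ 2) ⊕ -1ℤ ⊙ μ-sum s ⊕ + 2 ⊙ δ-hasSum s)))
    where
    split : ∀ m d → + 2 - m + + 2 * d ≡ + 2 + -1ℤ * m + + 2 * d
    split = solve-∀

  -- In the expansion of (2J - μ + 2I)² the terms in μ cancel: 4μ comes from μ² and -4μ from the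
  -- cross terms with 2I.
  A-square : ∀ s t → ∑[ u < 15 ] (A s u * A t u) ≡ + 4 + + 4 * δ s t
  A-square s t = begin
    ∑[ u < 15 ] (A s u * A t u)
      ≡⟨ sum-cong-≗ (λ u → expand (μ s u) (μ t u) (δ s u) (δ t u)) ⟩
    ∑[ u < 15 ] (+ 4 + - + 2 * μ s u + - + 2 * μ t u + μ s u * μ t u
      + + 2 * (δ s u * (+ 2 - μ t u)) + + 2 * (δ t u * (+ 2 - μ s u)) + + 4 * (δ s u * δ t u))
      ≡⟨ total (const-hasSum (+ 4) ⊕ - + 2 ⊙ μ-sum s ⊕ - + 2 ⊙ μ-sum t ⊕ μ-square s t
           ⊕ + 2 ⊙ δ*-hasSum (λ u → + 2 - μ t u) s ⊕ + 2 ⊙ δ*-hasSum (λ u → + 2 - μ s u) t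
           ⊕ + 4 ⊙ δ*-hasSum (δ t) s) ⟩
    + 60 + - + 48 + - + 48 + (+ 32 + + 4 * μ s t) + + 2 * (+ 2 - μ t s) + + 2 * (+ 2 - μ s t) + + 4 * δ t s
      ≡⟨ cong₂ (λ m d → + 60 + - + 48 + - + 48 + (+ 32 + + 4 * μ s t) + + 2 * (+ 2 - m) + + 2 * (+ 2 - μ s t) + + 4 * d)
           (μ-sym t s) (δ-sym t s) ⟩
    + 60 + - + 48 + - + 48 + (+ 32 + + 4 * μ s t) + + 2 * (+ 2 - μ s t) + + 2 * (+ 2 - μ s t) + + 4 * δ s t
      ≡⟨ collect (μ s t) (δ s t) ⟩
    + 4 + + 4 * δ s t ∎
    where
    open ≡-Reasoning
    expand : ∀ m n d e → (+ 2 - m + + 2 * d) * (+ 2 - n + + 2 * e) ≡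
      + 4 + - + 2 * m + - + 2 * n + m * n + + 2 * (d * (+ 2 - n)) + + 2 * (e * (+ 2 - m)) + + 4 * (d * e)
    expand = solve-∀
    collect : ∀ m d → + 60 + - + 48 + - + 48 + (+ 32 + + 4 * m) + + 2 * (+ 2 - m) + + 2 * (+ 2 - m) + + 4 * d ≡ + 4 + + 4 * d
    collect = solve-∀

  -- ∑ (A² - A) over a row is 8 - 8 = 0 and no integer k has k² < k.
  A-idem : ∀ s t → Idempotent (A s t)
  A-idem s t = ℤ.i-j≡0⇒i≡j (A s t * A s t) (A s t)
    (hasSum-0⇒≡0 {f = λ t → A s t * A s t - A s t} (λ t → ℤ.i≤j⇒0≤j-i (i≤i*i (A s t))) (hasSum (begin
      ∑[ t < 15 ] (A s t * A s t - A s t)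
        ≡⟨ sum-cong-≗ (λ t → cong (λ k → A s t * A s t + k) (sym (ℤ.-1*i≡-i (A s t)))) ⟩
      ∑[ t < 15 ] (A s t * A s t + -1ℤ * A s t)
        ≡⟨ total (hasSum {f = λ t → A s t * A s t} (A-square s s) ⊕ -1ℤ ⊙ A-degree s) ⟩
      + 4 + + 4 * δ s s + - + 8
        ≡⟨ cong (λ d → + 4 + + 4 * d + - + 8) (δ-refl s) ⟩
      0ℤ ∎)) t)
    where open ≡-Reasoning

  open Cliques A A-idem A-sym A-loopless A-degree A-square public

  -- Since every column meets `x` twice, μx is constantly 2 · 4 = 8; hence Ax = 2 · 5 - 8 + 2x.
  parallel⇒clique : ∀ {x} → (∀ t → Idempotent (x t)) → x HasSum + 5 →
    (∀ p → ∑[ t < 15 ] (x t * C p t) ≡ + 2) → Clique x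
  parallel⇒clique {x} x-idem x-size x-meet = record
    { idem   = x-idem
    ; size   = x-size
    ; degree = λ s → hasSum (begin
        ∑[ t < 15 ] (A s t * x t)
          ≡⟨ sum-cong-≗ (λ t → expand (x t) (μ s t) (δ s t)) ⟩
        ∑[ t < 15 ] (+ 2 * x t + -1ℤ * (x t * μ s t) + + 2 * (δ s t * x t))
          ≡⟨ total (+ 2 ⊙ x-size ⊕ -1ℤ ⊙ μ-scaled x (+ 2) x-meet s ⊕ + 2 ⊙ δ*-hasSum x s) ⟩
        + 2 + + 2 * x s ∎)
    }
    where
    open ≡-Reasoning
    expand : ∀ x m d → (+ 2 - m + + 2 * d) * x ≡ + 2 * x + -1ℤ * (x * m) + + 2 * (d * x)
    expand = solve-∀

  -- The symbols missing from each row.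

  module _
    (R : Fin 6 → Fin 15 → ℤ)
    (R-idem : ∀ i s → Idempotent (R i s))
    (R-size : ∀ i → R i HasSum + 10)
    (R-replication : ∀ s → (λ i → R i s) HasSum + 4)
    (R-meets-C : ∀ i p → (λ s → R i s * C p s) HasSum + 4)
    where

    private
      M : Fin 6 → Fin 15 → ℤ
      M i s = 1ℤ - R i s

      complement : ∀ k → 1ℤ - k ≡ 1ℤ + -1ℤ * k
      complement = solve-∀

      -- A column has 6 symbols, 4 of them in row `i`, which leaves 2 among the 15 - 10 = 5 missing
      -- ones.
      M-clique : ∀ i → Clique (M i)
      M-clique i = parallel⇒clique
        (λ s → idem-complement (R-idem i s))
        (hasSum (trans (sum-cong-≗ (λ s → complement (R i s)))
          (total (const-hasSum 1ℤ ⊕ -1ℤ ⊙ R-size i))))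
        (λ p → trans (sum-cong-≗ (λ s → expand (R i s) (C p s)))
          (total (C-size p ⊕ -1ℤ ⊙ R-meets-C i p)))
        where
        expand : ∀ r c → (1ℤ - r) * c ≡ c + -1ℤ * (r * c)
        expand = solve-∀

      M-replication : ∀ s → ∑[ i < 6 ] M i s ≡ + 2
      M-replication s = trans (sum-cong-≗ (λ i → complement (R i s)))
        (total (const-hasSum 1ℤ ⊕ -1ℤ ⊙ R-replication s))

      m : Fin 6 → Fin 6 → ℤ
      m i j = ∑[ s < 15 ] (M i s * M j s)

      m-refl : ∀ i → m i i ≡ + 5
      m-refl i = trans (sum-cong-≗ (Clique.idem (M-clique i))) (total (Clique.size (M-clique i)))

      -- Each of the 5 symbols missing from row `i` is missing from exactly two rows, row `i`
      -- included.
      m-sum : ∀ i → m i HasSum + 10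
      m-sum i = hasSum (begin
        ∑[ j < 6 ] ∑[ s < 15 ] (M i s * M j s)   ≡⟨ ∑-comm (λ j s → M i s * M j s) ⟩
        ∑[ s < 15 ] ∑[ j < 6 ] (M i s * M j s)   ≡⟨ sum-cong-≗ (λ s → sym (*-distribˡ-sum (M i s) (λ j → M j s))) ⟩
        ∑[ s < 15 ] (M i s * ∑[ j < 6 ] M j s)   ≡⟨ sum-cong-≗ (λ s → trans (cong (M i s *_) (M-replication s)) (ℤ.*-comm (M i s) (+ 2))) ⟩
        ∑[ s < 15 ] (+ 2 * M i s)                ≡⟨ total (+ 2 ⊙ Clique.size (M-clique i)) ⟩
        + 10                                     ∎)
        where open ≡-Reasoning

      -- The five entries m i j with j ≢ i are positive and sum to 5.
      m-≢ : ∀ {i j} → i ≢ j → m i j ≡ 1ℤ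
      m-≢ {i} {j} i≢j = ℤ.i-j≡0⇒i≡j (m i j) 1ℤ (trans excess-j (hasSum-0⇒≡0 excess-nonneg excess-sum j))
        where
        excess : Fin 6 → ℤ
        excess j = m i j - 1ℤ - + 4 * δ i j
        split : ∀ k d → k - 1ℤ - + 4 * d ≡ k + -1ℤ + - + 4 * d
        split = solve-∀
        excess-sum : excess HasSum 0ℤ
        excess-sum = hasSum (trans (sum-cong-≗ (λ j → split (m i j) (δ i j)))
          (total (m-sum i ⊕ const-hasSum -1ℤ ⊕ - + 4 ⊙ δ-hasSum i)))
        excess-nonneg : ∀ j → 0ℤ ≤ excess j
        excess-nonneg j with i ≟ j
        ... | yes refl = ℤ.≤-reflexive (sym (cong (λ k → k - 1ℤ - + 4) (m-refl i)))
        ... | no _     = subst (0ℤ ≤_) (sym (ℤ.+-identityʳ _))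
          (ℤ.i≤j⇒0≤j-i (cliques-meet (M-clique i) (M-clique j)))
        excess-j : m i j - 1ℤ ≡ excess j
        excess-j = trans (sym (ℤ.+-identityʳ _)) (cong (λ d → m i j - 1ℤ - + 4 * d) (sym (δ-≢ i≢j)))

      m-hasSum : ∀ i j → (λ s → M i s * M j s) HasSum m i j
      m-hasSum i j = hasSum refl

    rows-meet : ∀ {i j} → i ≢ j → ∑[ s < 15 ] (R i s * R j s) ≡ + 6
    rows-meet {i} {j} i≢j = begin
      ∑[ s < 15 ] (R i s * R j s)
        ≡⟨ sum-cong-≗ (λ s → inclusion-exclusion (R i s) (R j s)) ⟩
      ∑[ s < 15 ] (R i s + R j s + -1ℤ + M i s * M j s)
        ≡⟨ total (R-size i ⊕ R-size j ⊕ const-hasSum -1ℤ ⊕ m-hasSum i j) ⟩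
      + 5 + m i j
        ≡⟨ cong (λ k → + 5 + k) (m-≢ i≢j) ⟩
      + 6 ∎
      where
      open ≡-Reasoning
      inclusion-exclusion : ∀ a b → a * b ≡ a + b + -1ℤ + (1ℤ - a) * (1ℤ - b)
      inclusion-exclusion = solve-∀

-- From list lengths and subset cardinalities to integer sums.

length-filter-tabulate : ∀ {X : Set} {P : X → Set} (P? : Decidable P) {n} (f : Fin n → X) →
  + length (filter P? (List.tabulate f)) ≡ ∑[ i < n ] 𝟙 (does (P? (f i)))
length-filter-tabulate P? {zero}  f = refl
length-filter-tabulate P? {suc n} f with does (P? (f zero))
... | true  = cong (λ k → 1ℤ + k) (length-filter-tabulate P? (f ∘ suc))
... | false = trans (length-filter-tabulate P? (f ∘ suc)) (sym (ℤ.+-identityˡ _))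

length-filter-product : ∀ {X Y : Set} {P : X × Y → Set} (P? : Decidable P) {m n} (f : Fin m → X) (g : Fin n → Y) →
  + length (filter P? (cartesianProduct (List.tabulate f) (List.tabulate g)))
    ≡ ∑[ i < m ] ∑[ j < n ] 𝟙 (does (P? (f i , g j)))
length-filter-product P? {zero}  f g = refl
length-filter-product P? {suc m} {n} f g = begin
  + length (filter P? (List.map (f zero ,_) (List.tabulate g) ++ rows))
    ≡⟨ cong (+_ ∘ length) (List.filter-++ P? (List.map (f zero ,_) (List.tabulate g)) rows) ⟩
  + length (filter P? (List.map (f zero ,_) (List.tabulate g)) ++ filter P? rows)
    ≡⟨ cong +_ (List.length-++ (filter P? (List.map (f zero ,_) (List.tabulate g)))) ⟩
  + length (filter P? (List.map (f zero ,_) (List.tabulate g))) + + length (filter P? rows)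
    ≡⟨ cong₂ (λ xs k → + length (filter P? xs) + k) (List.map-tabulate g (f zero ,_)) (length-filter-product P? (f ∘ suc) g) ⟩
  + length (filter P? (List.tabulate (λ j → f zero , g j))) + ∑[ i < m ] ∑[ j < n ] 𝟙 (does (P? (f (suc i) , g j)))
    ≡⟨ cong (_+ ∑[ i < m ] ∑[ j < n ] 𝟙 (does (P? (f (suc i) , g j)))) (length-filter-tabulate P? (λ j → f zero , g j)) ⟩
  ∑[ i < suc m ] ∑[ j < n ] 𝟙 (does (P? (f i , g j))) ∎
  where
  open ≡-Reasoning
  rows : List _
  rows = cartesianProduct (List.tabulate (f ∘ suc)) (List.tabulate g)

∣tabulate∩tabulate∣ : ∀ {n} (p q : Fin n → Bool) →
  + ∣ tabulate p ∩ tabulate q ∣ ≡ ∑[ s < n ] (𝟙 (p s) * 𝟙 (q s))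
∣tabulate∩tabulate∣ {zero}  p q = refl
∣tabulate∩tabulate∣ {suc n} p q with p zero | q zero
... | true  | true  = cong (λ k → 1ℤ + k) (∣tabulate∩tabulate∣ (p ∘ suc) (q ∘ suc))
... | true  | false = trans (∣tabulate∩tabulate∣ (p ∘ suc) (q ∘ suc)) (sym (ℤ.+-identityˡ _))
... | false | true  = trans (∣tabulate∩tabulate∣ (p ∘ suc) (q ∘ suc)) (sym (ℤ.+-identityˡ _))
... | false | false = trans (∣tabulate∩tabulate∣ (p ∘ suc) (q ∘ suc)) (sym (ℤ.+-identityˡ _))

module _ {m n} (f : Fin m → Fin n) where

  -- The image counted with multiplicity. Being a sum, it allows summations to be interchanged; for
  -- injective `f` it agrees with the indicator of `image`.
  hits : Fin n → ℤ
  hits s = ∑[ i < m ] δ (f i) s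

  hits-size : hits HasSum + m
  hits-size = hasSum (begin
    ∑[ s < n ] ∑[ i < m ] δ (f i) s   ≡⟨ ∑-comm (λ s i → δ (f i) s) ⟩
    ∑[ i < m ] ∑[ s < n ] δ (f i) s   ≡⟨ sum-cong-≗ (λ i → total (δ-hasSum (f i))) ⟩
    ∑[ i < m ] 1ℤ                     ≡⟨ total (const-hasSum {m} 1ℤ) ⟩
    + m * 1ℤ                          ≡⟨ ℤ.*-identityʳ (+ m) ⟩
    + m                               ∎)
    where open ≡-Reasoning

  image : Fin n → Bool
  image s = ⌊ any? (λ i → f i ≟ s) ⌋

-- By induction on the domain: once the first value is `s`, injectivity makes all later terms
-- vanish.
𝟙-image : ∀ {m n} {f : Fin m → Fin n} → Injective _≡_ _≡_ f → ∀ s → 𝟙 (image f s) ≡ hits f s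
𝟙-image {f = f} f-inj s = trans (cong 𝟙 (isYes≗does (any? (λ i → f i ≟ s)))) (go f f-inj)
  where
  go : ∀ {m} (f : Fin m → Fin _) → Injective _≡_ _≡_ f → 𝟙 (does (any? (λ i → f i ≟ s))) ≡ hits f s
  go {zero}  f f-inj = refl
  go {suc m} f f-inj with f zero ≟ s
  ... | yes refl = cong (λ k → 1ℤ + k) (sym (trans
    (sum-cong-≗ {m} {λ i → δ (f (suc i)) (f zero)} {λ _ → 0ℤ} (λ i → δ-≢ {i = f (suc i)} {f zero} (λ eq → 1+≢0 (f-inj eq)))) (sum-replicate-zero m)))
    where
    1+≢0 : ∀ {i : Fin m} → suc i ≢ zero
    1+≢0 ()
  ... | no _     = trans (go (f ∘ suc) (suc-injective ∘ f-inj)) (sym (ℤ.+-identityˡ _))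

hits-idem : ∀ {m n} {f : Fin m → Fin n} → Injective _≡_ _≡_ f → ∀ s → Idempotent (hits f s)
hits-idem {f = f} f-inj s = subst Idempotent (𝟙-image f-inj s) (𝟙-idem (image f s))

∣image∩image∣ : ∀ {k m n} {f : Fin k → Fin n} {g : Fin m → Fin n} →
  Injective _≡_ _≡_ f → Injective _≡_ _≡_ g →
  ∑[ s < n ] (hits f s * hits g s) ≡ + ∣ tabulate (image f) ∩ tabulate (image g) ∣
∣image∩image∣ {f = f} {g} f-inj g-inj = sym (trans (∣tabulate∩tabulate∣ (image f) (image g))
  (sum-cong-≗ λ s → cong₂ _*_ (𝟙-image f-inj s) (𝟙-image g-inj s)))

-- Incidence counts in row-column designs.

module _ {r c v e : ℕ} {A : Array r c v} (D : IsRowColumnDesign e A) where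
  open IsRowColumnDesign D

  rowHits : Fin r → Fin v → ℤ
  rowHits i = hits (A i)

  colHits : Fin c → Fin v → ℤ
  colHits j = hits (λ i → A i j)

  rowHits-replication : ∀ s → (λ i → rowHits i s) HasSum + e
  rowHits-replication s = hasSum (trans
    -- `allFin` is a tabulation of the identity, hence the two identity functions.
    (sym (length-filter-product (λ (i , j) → A i j ≟ s) (λ i → i) (λ j → j)))
    (cong +_ (replication s)))

  colHits-replication : ∀ s → (λ j → colHits j s) HasSum + e
  colHits-replication s = hasSum (trans (∑-comm (λ j i → δ (A i j) s)) (total (rowHits-replication s)))

  -- Each of the `r` symbols of column `j` lies in `e` of the sets `N i`. Taking `N` to be the
  -- columns or the rows determines the constants of (CC) and (RC).
  hits-against : ∀ {m} (N : Fin m → Fin v → ℤ) → (∀ s → (λ i → N i s) HasSum + e) →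
    ∀ j → (λ i → ∑[ s < v ] (N i s * colHits j s)) HasSum + e * + r
  hits-against {m} N N-replication j = hasSum (begin
    ∑[ i < m ] ∑[ s < v ] (N i s * colHits j s)
      ≡⟨ ∑-comm (λ i s → N i s * colHits j s) ⟩
    ∑[ s < v ] ∑[ i < m ] (N i s * colHits j s)
      ≡⟨ sum-cong-≗ (λ s → sum-cong-≗ (λ i → ℤ.*-comm (N i s) (colHits j s))) ⟩
    ∑[ s < v ] ∑[ i < m ] (colHits j s * N i s)
      ≡⟨ sum-cong-≗ (λ s → trans (total (colHits j s ⊙ N-replication s)) (ℤ.*-comm (colHits j s) (+ e))) ⟩
    ∑[ s < v ] (+ e * colHits j s)
      ≡⟨ total (+ e ⊙ hits-size (λ i → A i j)) ⟩
    + e * + r ∎)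
    where open ≡-Reasoning

module _ {A : Array 6 10 15} (D : IsRowColumnDesign 4 A) where
  open IsRowColumnDesign D

  private
    C : Fin 10 → Fin 15 → ℤ
    C = colHits D

    R : Fin 6 → Fin 15 → ℤ
    R = rowHits D

  columns-gram : CC A → ∀ p q → ∑[ s < 15 ] (C p s * C q s) ≡ + 2 + + 4 * δ p q
  columns-gram (l , cc) p q = trans (gram q p) (trans (cong₂ (λ k d → k + (+ 6 - k) * d) l≡2 (δ-sym q p)) refl)
    where
    -- One formula for both cases, 6 on the diagonal and `l` off it, so that it can be summed over
    -- all columns.
    gram : ∀ p q → ∑[ s < 15 ] (C q s * C p s) ≡ + l + (+ 6 - + l) * δ p q
    gram p q with p ≟ q
    ... | yes refl = trans (sum-cong-≗ (hits-idem (col-distinct p))) (trans (total (hits-size (λ i → A i p))) (diagonal (+ l)))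
      where
      diagonal : ∀ k → + 6 ≡ k + (+ 6 - k) * 1ℤ
      diagonal = solve-∀
    ... | no p≢q   = trans (∣image∩image∣ (col-distinct q) (col-distinct p))
      (trans (cong +_ (cc q p (p≢q ∘ sym))) (off-diagonal (+ l)))
      where
      off-diagonal : ∀ k → k ≡ k + (+ 6 - k) * 0ℤ
      off-diagonal = solve-∀
    -- Column 0 against all ten columns: 10l + (6 - l) = 4 · 6, so 9l = 18.
    l≡2 : + l ≡ + 2
    l≡2 = ℤ.*-cancelˡ-≡ (+ 9) (+ l) (+ 2) (begin
      + 9 * + l
        ≡⟨ isolate (+ l) ⟩
      + 10 * + l + (+ 6 - + l) * 1ℤ - + 6
        ≡⟨ cong (_- + 6) (sym (trans (sum-cong-≗ (gram 0F)) (total (const-hasSum (+ l) ⊕ (+ 6 - + l) ⊙ δ-hasSum {10} 0F)))) ⟩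
      ∑[ q < 10 ] ∑[ s < 15 ] (C q s * C 0F s) - + 6
        ≡⟨ cong (_- + 6) (total (hits-against D C (colHits-replication D) 0F)) ⟩
      + 9 * + 2 ∎)
      where
      open ≡-Reasoning
      isolate : ∀ k → + 9 * k ≡ + 10 * k + (+ 6 - k) * 1ℤ - + 6
      isolate = solve-∀

  -- One column against all six rows: 6l = 4 · 6.
  row-meets-column : RC A → ∀ i p → (λ s → R i s * C p s) HasSum + 4
  row-meets-column (l , rc) i p = hasSum (trans (meet i) (ℤ.*-cancelˡ-≡ (+ 6) (+ l) (+ 4) (begin
    + 6 * + l                                    ≡⟨ sym (total (const-hasSum {6} (+ l))) ⟩
    ∑[ i < 6 ] (+ l)                             ≡⟨ sum-cong-≗ (λ i → sym (meet i)) ⟩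
    ∑[ i < 6 ] ∑[ s < 15 ] (R i s * C p s)       ≡⟨ total (hits-against D R (rowHits-replication D) p) ⟩
    + 6 * + 4                                    ∎)))
    where
    open ≡-Reasoning
    meet : ∀ i → ∑[ s < 15 ] (R i s * C p s) ≡ + l
    meet i = trans (∣image∩image∣ (row-distinct i) (col-distinct p)) (cong +_ (rc i p))

  CC∧RC⇒RR : CC A → RC A → RR A
  CC∧RC⇒RR cc rc = 6 , λ i i′ i≢i′ → ℤ.+-injective (trans
    (sym (∣image∩image∣ (row-distinct i) (row-distinct i′)))
    (ColumnDesign.rows-meet C
      (λ p → hits-idem (col-distinct p))
      (λ p → hits-size (λ i → A i p))
      (colHits-replication D)
      (columns-gram cc)
      R
      (λ i → hits-idem (row-distinct i))
      (λ i → hits-size (A i))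
      (rowHits-replication D)
      (row-meets-column rc)
      i≢i′))

-- Decision procedures and the two explicit arrays.

injective? : ∀ {m n} (f : Fin m → Fin n) → Dec (Injective _≡_ _≡_ f)
injective? f = map′ (λ h {i} {j} → h i j) (λ h i j → h)
  (all? λ i → all? λ j → (f i ≟ f j) →-dec (i ≟ j))

isRowColumnDesign? : ∀ {r c v} e (A : Array r c v) → Dec (IsRowColumnDesign e A)
isRowColumnDesign? e A = map′
  (λ (rows , cols , reps) → record { row-distinct = rows ; col-distinct = cols ; replication = reps })
  (λ D → let open IsRowColumnDesign D in row-distinct , col-distinct , replication)
  ((all? λ i → injective? (A i)) ×-dec (all? λ j → injective? (λ i → A i j)) ×-dec (all? λ s → occurrences A s ℕ.≟ e))

-- With `k` given in advance the check is finite; the existential over ℕ in `RR` and `CC` is not.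
constant-off-diagonal? : ∀ {n} (f : Fin n → Fin n → ℕ) k → Dec (∀ i j → i ≢ j → f i j ≡ k)
constant-off-diagonal? f k = all? λ i → all? λ j → ¬? (i ≟ j) →-dec (f i j ℕ.≟ k)

-- The reduction modulo 15 only turns numerals into elements of `Fin 15`: all entries used below are
-- less than 15.
fromRows : Vec (Vec ℕ 10) 6 → Array 6 10 15
fromRows rows i j = lookup (lookup rows i) j mod 15

-- Symbols 0, …, 14 are the edges of K₆ in lexicographic order; row i holds the
-- edges avoiding vertex i, and column j the edges of a pair of disjoint triangles.
tripleArray : Array 6 10 15
tripleArray = fromRows
  ( ( 5 ∷  6 ∷ 11 ∷  9 ∷  7 ∷ 13 ∷ 12 ∷  8 ∷ 10 ∷ 14 ∷ [])
  ∷ (12 ∷ 14 ∷  3 ∷ 10 ∷  2 ∷  1 ∷  4 ∷ 11 ∷ 13 ∷  9 ∷ [])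
  ∷ (13 ∷  0 ∷  7 ∷  8 ∷ 14 ∷  3 ∷  6 ∷ 12 ∷  2 ∷  4 ∷ [])
  ∷ (14 ∷ 11 ∷  0 ∷  4 ∷  8 ∷ 10 ∷  1 ∷  3 ∷  7 ∷  5 ∷ [])
  ∷ ( 1 ∷  2 ∷ 13 ∷  0 ∷  9 ∷  8 ∷ 11 ∷  5 ∷  4 ∷  6 ∷ [])
  ∷ ( 0 ∷ 10 ∷  9 ∷ 12 ∷  1 ∷  6 ∷  7 ∷  2 ∷  5 ∷  3 ∷ [])
  ∷ [])

properAOArray : Array 6 10 15
properAOArray = fromRows
  ( ( 6 ∷  9 ∷  8 ∷  7 ∷  5 ∷ 11 ∷ 10 ∷ 12 ∷ 13 ∷ 14 ∷ [])
  ∷ ( 9 ∷  3 ∷ 12 ∷ 11 ∷  4 ∷ 14 ∷ 13 ∷  8 ∷ 10 ∷  2 ∷ [])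
  ∷ (14 ∷ 13 ∷  6 ∷  4 ∷  2 ∷  0 ∷  7 ∷  3 ∷  1 ∷  5 ∷ [])
  ∷ ( 1 ∷ 10 ∷  0 ∷  6 ∷ 11 ∷  7 ∷  3 ∷ 14 ∷  4 ∷ 12 ∷ [])
  ∷ ( 4 ∷  7 ∷ 13 ∷  2 ∷ 12 ∷  9 ∷  8 ∷  1 ∷  5 ∷  0 ∷ [])
  ∷ ( 8 ∷  1 ∷  3 ∷  9 ∷  6 ∷  2 ∷  0 ∷  5 ∷ 11 ∷ 10 ∷ [])
  ∷ [])

tripleArray-isTriple : IsTripleArray 4 tripleArray
tripleArray-isTriple =
    from-yes (isRowColumnDesign? 4 tripleArray)
  , (6 , from-yes (constant-off-diagonal? (λ i i′ → ∣ rowSet tripleArray i ∩ rowSet tripleArray i′ ∣) 6))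
  , (2 , from-yes (constant-off-diagonal? (λ j j′ → ∣ colSet tripleArray j ∩ colSet tripleArray j′ ∣) 2))
  , (4 , from-yes (all? λ i → all? λ j → ∣ rowSet tripleArray i ∩ colSet tripleArray j ∣ ℕ.≟ 4))

properAOArray-isProperAO : IsProperAOArray 4 properAOArray
properAOArray-isProperAO =
    from-yes (isRowColumnDesign? 4 properAOArray)
  , (4 , from-yes (all? λ i → all? λ j → ∣ rowSet properAOArray i ∩ colSet properAOArray j ∣ ℕ.≟ 4))
  -- Rows 0 and 1 share 7 symbols, rows 0 and 2 only 5.
  , (λ (_ , rr) → case trans (rr 0F 1F λ ()) (sym (rr 0F 2F λ ())) of λ ())
  -- Columns 0 and 1 share 2 symbols, columns 0 and 3 share 3.
  , (λ (_ , cc) → case trans (cc 0F 1F λ ()) (sym (cc 0F 3F λ ())) of λ ())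

mainTheorem5 : (¬ (Σ[ A ∈ Array 6 10 15 ] IsProperTransposedSesquiArray 4 A))
    × (Σ[ A ∈ Array 6 10 15 ] IsProperAOArray 4 A)
    × (Σ[ A ∈ Array 6 10 15 ] IsTripleArray 4 A)
mainTheorem5 =
    (λ (_ , D , cc , rc , ¬rr) → ¬rr (CC∧RC⇒RR D cc rc))
  , (properAOArray , properAOArray-isProperAO)
  , (tripleArray , tripleArray-isTriple)
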